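{- For each integer $n\ge 1$, the path $P_n$ with $n$ vertices satisfies $$M(P_n)=\left\lfloor\frac{(n+1)^2}{4}\right\rfloor=\left\lfloor\frac{n+1}{2}\right\rfloor\cdot\left\lceil\frac{n+1}{2}\right\rceil.$$
   Context: Graphs are finite, simple and undirected. $P_n$ is the graph with vertex set $\{1,\dots,n\}$ and edge set $\{\{i,i+1\} : 1\le i\le n-1\}$ (for $n=1$ this is a single vertex without edges). For a graph $\mathcal{G}$ with $n$ vertices and adjacency matrix $A$, viewed over $\mathbb{F}_2$, let $C(\mathcal{G})\subseteq\mathbb{F}_2^{2n}$ be the binary linear code generated by the rows of $[I_n|A]$, where $I_n$ is the $n\times n$ identity matrix. The support of a vector is the set of positions of its nonzero entries. A nonzero codeword $c$ of a binary linear code $C$ is minimal if there is no nonzero codeword $c'\in C$ with $\operatorname{supp}(c')\subsetneq\operatorname{supp}(c)$. $M(\mathcal{G})$ denotes the number of minimal codewords of $C(\mathcal{G})$; it does not depend on the labeling of the vertices. -}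

module Defs where

open import Data.Bool.Base using (if_then_else_)
open import Data.Fin.Base using (Fin; toℕ)
open import Data.Fin.Subset using (Subset; _⊂_)
open import Data.Fin.Subset.Properties using (_⊂?_)
open import Data.List.Base using (List; []; _∷_; length; filter; cartesianProductWith)
open import Data.List.Membership.Propositional using (_∈_; lose)
open import Data.List.Membership.Propositional.Properties
  using (∈-cartesianProductWith⁺)
open import Data.List.Relation.Unary.All using ([]; _∷_)
open import Data.List.Relation.Unary.Any using (here; there; any?; satisfied)
open import Data.List.Relation.Unary.AllPairs using ([]; _∷_)
open import Data.List.Relation.Unary.Unique.Propositional using (Unique)
open import Data.List.Relation.Unary.Unique.Propositional.Properties
  using (cartesianProductWith⁺)
open import Data.Nat.Base as ℕ using (ℕ; zero; suc)
import Data.Nat.Properties as ℕ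
open import Data.Parity.Base using (Parity; 0ℙ; 1ℙ; _+_; _*_)
open import Data.Parity.Properties using (_≟_)
open import Data.Product.Base using (∃; _×_; _,_)
open import Data.Sum.Base using (_⊎_; inj₁; inj₂; swap)
open import Data.Vec.Base
  using (Vec; []; _∷_; map; zipWith; replicate; tabulate; _++_)
import Data.Vec.Properties as Vec
open import Level using (0ℓ)
open import Relation.Binary.Core using (Rel)
open import Relation.Binary.Definitions using (Symmetric; Decidable)
open import Relation.Binary.PropositionalEquality using (_≡_; _≢_; refl; sym)
open import Relation.Nullary using (Dec; does; ¬_; ¬?; _×-dec_; _⊎-dec_; map′)
open import Relation.Unary as U using (Pred)

------------------------------------------------------------------------
-- Graphs

-- Finite simple undirected graphs, with vertices labelled by Fin n.
record Graph (n : ℕ) : Set₁ where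
  field
    _∼_    : Rel (Fin n) 0ℓ
    ∼-sym  : Symmetric _∼_
    ∼-loop : ∀ {i} → ¬ (i ∼ i)
    _∼?_   : Decidable _∼_

-- The vertex i of the path is represented by the element i ∸ 1 of Fin n.
path : ∀ n → Graph n
path n = record
  { _∼_    = λ i j → (toℕ j ≡ suc (toℕ i)) ⊎ (toℕ i ≡ suc (toℕ j))
  ; ∼-sym  = swap
  ; ∼-loop = λ { (inj₁ eq) → ℕ.1+n≢n (sym eq) ; (inj₂ eq) → ℕ.1+n≢n (sym eq) }
  ; _∼?_   = λ i j →
      (toℕ j ℕ.≟ suc (toℕ i)) ⊎-dec (toℕ i ℕ.≟ suc (toℕ j))
  }

------------------------------------------------------------------------
-- Vectors and matrices over the two-element field

-- Parity, with the library's addition and multiplication, is the field 𝔽₂.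
𝔽₂ : Set
𝔽₂ = Parity

𝔽₂^_ : ℕ → Set
𝔽₂^ m = Vec 𝔽₂ m

-- A matrix is the vector of its rows.
Matrix : ℕ → ℕ → Set
Matrix k m = Vec (𝔽₂^ m) k

0ᵥ : ∀ {m} → 𝔽₂^ m
0ᵥ = replicate _ 0ℙ

_+ᵥ_ : ∀ {m} → 𝔽₂^ m → 𝔽₂^ m → 𝔽₂^ m
_+ᵥ_ = zipWith _+_

_*ᵥ_ : ∀ {m} → 𝔽₂ → 𝔽₂^ m → 𝔽₂^ m
a *ᵥ v = map (a *_) v

linearCombination : ∀ {k m} → 𝔽₂^ k → Matrix k m → 𝔽₂^ m
linearCombination []       []       = 0ᵥ
linearCombination (a ∷ as) (v ∷ vs) = (a *ᵥ v) +ᵥ linearCombination as vs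

matrix : ∀ {k m} → (Fin k → Fin m → 𝔽₂) → Matrix k m
matrix f = tabulate (λ i → tabulate (f i))

identity : ∀ n → Matrix n n
identity n = matrix (λ i j → if does (toℕ i ℕ.≟ toℕ j) then 1ℙ else 0ℙ)

adjacency : ∀ {n} → Graph n → Matrix n n
adjacency G = matrix (λ i j → if does (i ∼? j) then 1ℙ else 0ℙ)
  where open Graph G

-- The block matrix [ A | B ].
_∣∣_ : ∀ {k m m′} → Matrix k m → Matrix k m′ → Matrix k (m ℕ.+ m′)
_∣∣_ = zipWith _++_

------------------------------------------------------------------------
-- Linear codes and minimal codewords

Code : ℕ → Set₁
Code m = Pred (𝔽₂^ m) 0ℓ

generatedBy : ∀ {k m} → Matrix k m → Code m
generatedBy R c = ∃ λ x → linearCombination x R ≡ c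

code : ∀ {n} → Graph n → Code (n ℕ.+ n)
code {n} G = generatedBy (identity n ∣∣ adjacency G)

supp : ∀ {m} → 𝔽₂^ m → Subset m
supp = map (λ a → does (¬? (a ≟ 0ℙ)))

IsMinimal : ∀ {m} → Code m → 𝔽₂^ m → Set
IsMinimal C c =
  C c × c ≢ 0ᵥ × ¬ (∃ λ c′ → C c′ × c′ ≢ 0ᵥ × supp c′ ⊂ supp c)

------------------------------------------------------------------------
-- Counting

allVectors : ∀ m → List (𝔽₂^ m)
allVectors zero    = [] ∷ []
allVectors (suc m) = cartesianProductWith _∷_ (0ℙ ∷ 1ℙ ∷ []) (allVectors m)

allVectors-complete : ∀ {m} (v : 𝔽₂^ m) → v ∈ allVectors m
allVectors-complete []       = here refl
allVectors-complete (a ∷ v) =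
  ∈-cartesianProductWith⁺ _∷_ (a∈𝔽₂ a) (allVectors-complete v)
  where
  a∈𝔽₂ : ∀ a → a ∈ (0ℙ ∷ 1ℙ ∷ [])
  a∈𝔽₂ 0ℙ = here refl
  a∈𝔽₂ 1ℙ = there (here refl)

allVectors-unique : ∀ m → Unique (allVectors m)
allVectors-unique zero    = [] ∷ []
allVectors-unique (suc m) =
  cartesianProductWith⁺ _∷_ Vec.∷-injective
    (((λ ()) ∷ []) ∷ [] ∷ []) (allVectors-unique m)

∃? : ∀ {m} {P : Pred (𝔽₂^ m) 0ℓ} → U.Decidable P → Dec (∃ P)
∃? P? = map′ satisfied (λ (v , p) → lose (allVectors-complete v) p)
             (any? P? (allVectors _))

_≟ᵥ_ : ∀ {m} (u v : 𝔽₂^ m) → Dec (u ≡ v)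
_≟ᵥ_ = Vec.≡-dec _≟_

generatedBy? : ∀ {k m} (R : Matrix k m) → U.Decidable (generatedBy R)
generatedBy? R c = ∃? (λ x → linearCombination x R ≟ᵥ c)

isMinimal? : ∀ {m} {C : Code m} → U.Decidable C → U.Decidable (IsMinimal C)
isMinimal? C? c =
  C? c ×-dec ¬? (c ≟ᵥ 0ᵥ) ×-dec
  ¬? (∃? (λ c′ → C? c′ ×-dec ¬? (c′ ≟ᵥ 0ᵥ) ×-dec (supp c′ ⊂? supp c)))

code? : ∀ {n} (G : Graph n) → U.Decidable (code G)
code? {n} G = generatedBy? (identity n ∣∣ adjacency G)

-- allVectors lists every vector exactly once, so this length is the number
-- of minimal codewords.
M : ∀ {n} → Graph n → ℕ
M {n} G = length (filter (isMinimal? (code? G)) (allVectors (n ℕ.+ n)))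

{-# OPTIONS --safe #-}
module Submission where

-- Write N x for the vector whose entry at a vertex is the sum of x over the
-- neighbours of that vertex.  The codewords are the vectors (x , N x), so they
-- correspond to the sets x of vertices.  In a path the vertex i has only the
-- neighbours i - 1 and i + 1.  Hence for y contained in x the inclusion
-- supp (N y) inside supp (N x) says exactly that whenever i - 1 and i + 1 both
-- lie in x, either both or neither of them lies in y: y is a union of
-- connected components of x under the relation "at distance two".  The minimal
-- codewords therefore come from the nonempty x with a single component, the
-- runs { i , i + 2 , ... , i + 2k }.
--
-- The two halves of this argument are run-multiple (a codeword supported
-- inside that of a run is a scalar multiple of it) and run-below (every
-- nonzero codeword has inside its support the codeword of a run).
--
-- Exactly ⌊ n /2⌋ + 1 of the runs on n + 1 vertices contain the first vertex,
-- so their number satisfies r (n + 1) = r n + ⌊ n /2⌋ + 1 with r 0 = 0, and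
-- r n = ⌊ n + 1 /2⌋ * ⌈ n + 1 /2⌉ follows by induction (length-runs).
-- The list of minimal codewords and the list of codewords of runs have no
-- repetitions and the same members, hence the same length.

open import Defs
open import Data.Bool.Base using (if_then_else_)
open import Data.Empty using (⊥-elim)
open import Data.Fin.Base using (Fin; zero; suc; toℕ)
open import Data.Fin.Subset as Subset using (_⊆_; _⊂_)
open import Data.Fin.Subset.Properties
  using (_∈?_; ⊆-antisym; out⊆; in⊆in; drop-∷-⊆)
open import Data.List.Base as List using (List; []; _∷_; length; filter)
import Data.List.Properties as List
open import Data.List.Membership.Propositional using (_∈_)
open import Data.List.Membership.Propositional.Properties
  using (∈-map⁺; ∈-map⁻; ∈-++⁺ˡ; ∈-++⁺ʳ; ∈-++⁻; ∈-filter⁺; ∈-filter⁻)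
open import Data.List.Membership.Propositional.Properties.WithK
  using (unique∧set⇒bag)
open import Data.List.Relation.Binary.BagAndSetEquality using (∼bag⇒↭)
open import Data.List.Relation.Binary.Permutation.Propositional.Properties
  using (↭-length)
open import Data.List.Relation.Unary.All as All using ([]; _∷_)
open import Data.List.Relation.Unary.AllPairs using ([]; _∷_)
open import Data.List.Relation.Unary.Any using (here; there)
open import Data.List.Relation.Unary.Unique.Propositional using (Unique)
import Data.List.Relation.Unary.Unique.Propositional.Properties as Unique
open import Data.Nat.Base using (ℕ; _+_; _*_; _^_; _/_; _≤_; ⌊_/2⌋; ⌈_/2⌉; zero; suc)
open import Data.Nat.DivMod using (+-distrib-/-∣ˡ; m*n/n≡m)
open import Data.Nat.Divisibility using (n∣m*n)
import Data.Nat.Properties as ℕ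
open import Data.Nat.Tactic.RingSolver using (solve-∀)
open import Data.Parity.Base as ℙ using (0ℙ; 1ℙ)
import Data.Parity.Properties as ℙ
open import Data.Product.Base using (_×_; ∃; _,_)
open import Data.Sum.Base using (inj₁; inj₂)
open import Data.Vec.Base as Vec using ([]; _∷_; _++_; tabulate)
import Data.Vec.Properties as Vec
open import Data.Vec.Relation.Binary.Pointwise.Inductive as Pointwise
  using (Pointwise; []; _∷_)
open import Function.Base using (_∘_)
open import Function.Bundles using (mk⇔)
open import Relation.Binary.PropositionalEquality
  using (_≡_; _≢_; refl; sym; trans; cong; cong₂; subst; module ≡-Reasoning)
open import Relation.Nullary using (¬_; does; yes; no)

-- Codewords of the path

-- The first entry, or 0 for the empty vector: beyond the right end of the path
-- nothing contributes to a neighbour sum.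
first : ∀ {n} → 𝔽₂^ n → 𝔽₂
first []      = 0ℙ
first (a ∷ _) = a

-- The vector of neighbour sums of x on a path, when a vertex carrying the
-- value p is attached to the left of the first vertex.  For the path itself
-- p is 0; the other value appears when the recursion moves to the right.
neighbourSums : ∀ {n} → 𝔽₂ → 𝔽₂^ n → 𝔽₂^ n
neighbourSums p []      = []
neighbourSums p (a ∷ x) = (p ℙ.+ first x) ∷ neighbourSums a x

-- The linear combination of the generating rows with coefficients x, by
-- linearCombination-code.
codeword : ∀ {n} → 𝔽₂^ n → 𝔽₂^ (n + n)
codeword x = x ++ neighbourSums 0ℙ x

+ᵥ-identityˡ : ∀ {m} (v : 𝔽₂^ m) → 0ᵥ +ᵥ v ≡ v
+ᵥ-identityˡ = Vec.zipWith-identityˡ ℙ.+-identityˡ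

*ᵥ-zeroʳ : ∀ {m} a → a *ᵥ 0ᵥ {m} ≡ 0ᵥ
*ᵥ-zeroʳ a = trans (Vec.map-replicate (a ℙ.*_) 0ℙ _)
                   (cong (Vec.replicate _) (ℙ.*-zeroʳ a))

*ᵥ-zeroˡ : ∀ {m} (v : 𝔽₂^ m) → 0ℙ *ᵥ v ≡ 0ᵥ
*ᵥ-zeroˡ v = Vec.map-const v 0ℙ

*ᵥ-identityˡ : ∀ {m} (v : 𝔽₂^ m) → 1ℙ *ᵥ v ≡ v
*ᵥ-identityˡ = Vec.map-id

tabulate-0 : ∀ m → tabulate {n = m} (λ _ → 0ℙ) ≡ 0ᵥ
tabulate-0 zero    = refl
tabulate-0 (suc m) = cong (0ℙ ∷_) (tabulate-0 m)

-- A multiple of a zero row contributes nothing.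
zero-row : ∀ {m} a (v : 𝔽₂^ m) → (a *ᵥ tabulate (λ _ → 0ℙ)) +ᵥ v ≡ v
zero-row {m} a v rewrite tabulate-0 m | *ᵥ-zeroʳ {m} a = +ᵥ-identityˡ v

-- The sum of the products of the entries of x with those of the column g.
dot : ∀ {k} → 𝔽₂^ k → (Fin k → 𝔽₂) → 𝔽₂
dot []      g = 0ℙ
dot (a ∷ x) g = (a ℙ.* g zero) ℙ.+ dot x (g ∘ suc)

dot-zeroʳ : ∀ {k} (x : 𝔽₂^ k) → dot x (λ _ → 0ℙ) ≡ 0ℙ
dot-zeroʳ []      = refl
dot-zeroʳ (a ∷ x) rewrite ℙ.*-zeroʳ a = dot-zeroʳ x

-- A linear combination of rows, split into its first entry and the combination
-- of the rows with the first column removed.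
linearCombination-column : ∀ {k m} (x : 𝔽₂^ k) (f : Fin k → Fin (suc m) → 𝔽₂) →
  linearCombination x (matrix f) ≡
  dot x (λ i → f i zero) ∷ linearCombination x (matrix (λ i j → f i (suc j)))
linearCombination-column []      f = refl
linearCombination-column (a ∷ x) f =
  cong ((a *ᵥ tabulate (f zero)) +ᵥ_) (linearCombination-column x (f ∘ suc))

0ᵥ-++ : ∀ m {m′} → 0ᵥ {m + m′} ≡ 0ᵥ {m} ++ 0ᵥ {m′}
0ᵥ-++ zero    = refl
0ᵥ-++ (suc m) = cong (0ℙ ∷_) (0ᵥ-++ m)

linearCombination-∣∣ : ∀ {k m m′} x (A : Matrix k m) (B : Matrix k m′) →
  linearCombination x (A ∣∣ B) ≡ linearCombination x A ++ linearCombination x B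
linearCombination-∣∣ {m = m} [] [] [] = 0ᵥ-++ m
linearCombination-∣∣ (a ∷ x) (u ∷ A) (v ∷ B)
  rewrite linearCombination-∣∣ x A B | Vec.map-++ (a ℙ.*_) u v
  = Vec.zipWith-++ ℙ._+_ (a *ᵥ u) (a *ᵥ v) _ _

linearCombination-identity : ∀ {n} (x : 𝔽₂^ n) →
  linearCombination x (identity n) ≡ x
linearCombination-identity []      = refl
linearCombination-identity {suc n} (a ∷ x) = begin
  (a *ᵥ (1ℙ ∷ tabulate (λ _ → 0ℙ))) +ᵥ linearCombination x (matrix (δ ∘ suc))
    ≡⟨ cong ((a *ᵥ (1ℙ ∷ tabulate (λ _ → 0ℙ))) +ᵥ_)
         (linearCombination-column x (δ ∘ suc)) ⟩
  ((a ℙ.* 1ℙ) ℙ.+ dot x (λ _ → 0ℙ)) ∷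
    ((a *ᵥ tabulate (λ _ → 0ℙ)) +ᵥ linearCombination x (identity n))
    ≡⟨ cong₂ _∷_ (cong₂ ℙ._+_ (ℙ.*-identityʳ a) (dot-zeroʳ x)) (zero-row a _) ⟩
  (a ℙ.+ 0ℙ) ∷ linearCombination x (identity n)
    ≡⟨ cong₂ _∷_ (ℙ.+-identityʳ a) (linearCombination-identity x) ⟩
  a ∷ x ∎
  where
  open ≡-Reasoning
  -- The entries of the identity matrix.
  δ : Fin (suc n) → Fin (suc n) → 𝔽₂
  δ i j = if does (toℕ i ℕ.≟ toℕ j) then 1ℙ else 0ℙ

linearCombination-adjacency : ∀ {n} (x : 𝔽₂^ n) →
  linearCombination x (adjacency (path n)) ≡ neighbourSums 0ℙ x
linearCombination-adjacency []            = refl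
linearCombination-adjacency (a ∷ [])      rewrite ℙ.*-zeroʳ a = refl
linearCombination-adjacency {suc n} (a ∷ x@(b ∷ x′)) = begin
  (a *ᵥ row) +ᵥ linearCombination x (matrix (adj ∘ suc))
    ≡⟨ cong ((a *ᵥ row) +ᵥ_) (linearCombination-column x (adj ∘ suc)) ⟩
  (a ℙ.* 0ℙ ℙ.+ (b ℙ.* 1ℙ ℙ.+ dot x′ (λ _ → 0ℙ))) ∷
    ((a *ᵥ Vec.tail row) +ᵥ linearCombination x (adjacency (path n)))
    ≡⟨ cong₂ _∷_
         (cong₂ ℙ._+_ (ℙ.*-zeroʳ a) (cong₂ ℙ._+_ (ℙ.*-identityʳ b) (dot-zeroʳ x′)))
         (cong ((a *ᵥ Vec.tail row) +ᵥ_) (linearCombination-adjacency x)) ⟩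
  (b ℙ.+ 0ℙ) ∷ (a ℙ.* 1ℙ ℙ.+ first x′) ∷
    ((a *ᵥ tabulate (λ _ → 0ℙ)) +ᵥ neighbourSums b x′)
    ≡⟨ cong₂ _∷_ (ℙ.+-identityʳ b)
         (cong₂ _∷_ (cong (ℙ._+ first x′) (ℙ.*-identityʳ a)) (zero-row a _)) ⟩
  neighbourSums 0ℙ (a ∷ x) ∎
  where
  open ≡-Reasoning
  -- The entries of the adjacency matrix.
  adj : Fin (suc n) → Fin (suc n) → 𝔽₂
  adj i j = if does (Graph._∼?_ (path (suc n)) i j) then 1ℙ else 0ℙ
  -- The first row of the adjacency matrix: only the second vertex is adjacent.
  row : 𝔽₂^ (suc n)
  row = 0ℙ ∷ 1ℙ ∷ tabulate (λ _ → 0ℙ)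

linearCombination-code : ∀ {n} (x : 𝔽₂^ n) →
  linearCombination x (identity n ∣∣ adjacency (path n)) ≡ codeword x
linearCombination-code {n} x =
  trans (linearCombination-∣∣ x (identity n) (adjacency (path n)))
        (cong₂ _++_ (linearCombination-identity x) (linearCombination-adjacency x))

codeword-injective : ∀ {n} {x y : 𝔽₂^ n} → codeword x ≡ codeword y → x ≡ y
codeword-injective {x = x} {y} = Vec.++-injectiveˡ x y

neighbourSums-0 : ∀ n → neighbourSums 0ℙ (0ᵥ {n}) ≡ 0ᵥ
neighbourSums-0 zero          = refl
neighbourSums-0 (suc zero)    = refl
neighbourSums-0 (suc (suc n)) = cong (0ℙ ∷_) (neighbourSums-0 (suc n))

codeword-0 : ∀ n → codeword (0ᵥ {n}) ≡ 0ᵥ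
codeword-0 n = trans (cong (0ᵥ {n} ++_) (neighbourSums-0 n)) (sym (0ᵥ-++ n))

codeword≢0 : ∀ {n} {x : 𝔽₂^ n} → x ≢ 0ᵥ → codeword x ≢ 0ᵥ
codeword≢0 {n} x≢0 eq = x≢0 (codeword-injective (trans eq (sym (codeword-0 n))))

-- Inclusion of supports

-- The order on the field with 0 below 1.
data _≤₂_ : 𝔽₂ → 𝔽₂ → Set where
  0≤_ : ∀ a → 0ℙ ≤₂ a
  1≤1 : 1ℙ ≤₂ 1ℙ

-- Coordinatewise order, equivalent to inclusion of supports.
_≼_ : ∀ {m} → 𝔽₂^ m → 𝔽₂^ m → Set
_≼_ = Pointwise _≤₂_

⊆⇒≼ : ∀ {m} (u v : 𝔽₂^ m) → supp u ⊆ supp v → u ≼ v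
⊆⇒≼ []       []       _  = []
⊆⇒≼ (0ℙ ∷ u) (b ∷ v)  le = (0≤ b) ∷ ⊆⇒≼ u v (drop-∷-⊆ le)
⊆⇒≼ (1ℙ ∷ u) (1ℙ ∷ v) le = 1≤1 ∷ ⊆⇒≼ u v (drop-∷-⊆ le)
⊆⇒≼ (1ℙ ∷ u) (0ℙ ∷ v) le with () ← le Vec.here

≼⇒⊆ : ∀ {m} {u v : 𝔽₂^ m} → u ≼ v → supp u ⊆ supp v
≼⇒⊆ []           = λ ()
≼⇒⊆ ((0≤ b) ∷ le) = out⊆ (≼⇒⊆ le)
≼⇒⊆ (1≤1 ∷ le)   = in⊆in (≼⇒⊆ le)

supp-injective : ∀ {m} {u v : 𝔽₂^ m} → supp u ≡ supp v → u ≡ v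
supp-injective {u = []}     {[]}     _  = refl
supp-injective {u = 0ℙ ∷ u} {0ℙ ∷ v} eq = cong (0ℙ ∷_) (supp-injective (Vec.∷-injectiveʳ eq))
supp-injective {u = 1ℙ ∷ u} {1ℙ ∷ v} eq = cong (1ℙ ∷_) (supp-injective (Vec.∷-injectiveʳ eq))
supp-injective {u = 0ℙ ∷ u} {1ℙ ∷ v} eq with () ← Vec.∷-injectiveˡ eq
supp-injective {u = 1ℙ ∷ u} {0ℙ ∷ v} eq with () ← Vec.∷-injectiveˡ eq

0≼ : ∀ {m} (v : 𝔽₂^ m) → 0ᵥ ≼ v
0≼ []      = []
0≼ (a ∷ v) = (0≤ a) ∷ 0≼ v

≼0⇒≡0 : ∀ {m} {u : 𝔽₂^ m} → u ≼ 0ᵥ → u ≡ 0ᵥ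
≼0⇒≡0 {zero}  []              = refl
≼0⇒≡0 {suc m} ((0≤ .0ℙ) ∷ le) = cong (0ℙ ∷_) (≼0⇒≡0 le)

first-mono : ∀ {n} {x y : 𝔽₂^ n} → x ≼ y → first x ≤₂ first y
first-mono []       = 0≤ 0ℙ
first-mono (le ∷ _) = le

+≤0⇒≡ : ∀ {a b} → (a ℙ.+ b) ≤₂ 0ℙ → a ≡ b
+≤0⇒≡ {0ℙ} {0ℙ} _ = refl
+≤0⇒≡ {1ℙ} {1ℙ} _ = refl

-- Runs

-- The words that may follow the first 1 of a run: (01)ᵏ0…0.
tails : ∀ n → List (𝔽₂^ n)
tails zero          = [] ∷ []
tails (suc zero)    = (0ℙ ∷ []) ∷ []
tails (suc (suc n)) = 0ᵥ ∷ List.map (λ x → 0ℙ ∷ 1ℙ ∷ x) (tails n)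

-- The words 0…01(01)ᵏ0…0, indicator vectors of nonempty arithmetic
-- progressions of difference two.
runs : ∀ n → List (𝔽₂^ n)
runs zero    = []
runs (suc n) = List.map (0ℙ ∷_) (runs n) List.++ List.map (1ℙ ∷_) (tails n)

-- If y is contained in the tail x, and its neighbour sums, with the value b
-- attached on the left, are contained in those of x with the value 1 attached,
-- then y is b times x: the sum over the neighbours of each 0 between two 1s
-- vanishes, so b propagates along the tail.
tail-multiple : ∀ {n b} {x y : 𝔽₂^ n} → x ∈ tails n →
  y ≼ x → neighbourSums b y ≼ neighbourSums 1ℙ x → y ≡ b *ᵥ x
tail-multiple {zero} {y = []} (here refl) _ _ = refl
tail-multiple {suc zero} {b} (here refl) ((0≤ _) ∷ []) _ =
  cong (_∷ []) (sym (ℙ.*-zeroʳ b))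
tail-multiple {suc (suc n)} {b} (here refl) y≼0 _ =
  trans (≼0⇒≡0 y≼0) (sym (*ᵥ-zeroʳ b))
tail-multiple {suc (suc n)} {b} (there x∈) y≼x Ny≼Nx with ∈-map⁻ _ x∈
tail-multiple {suc (suc n)} {b} {y = 0ℙ ∷ c ∷ y} (there _) (_ ∷ _ ∷ y≼x) (b+c≤0 ∷ _ ∷ Ny≼Nx)
  | x , x∈ , refl with refl ← +≤0⇒≡ {b} {c} b+c≤0 =
  cong₂ _∷_ (sym (ℙ.*-zeroʳ b))
    (cong₂ _∷_ (sym (ℙ.*-identityʳ b)) (tail-multiple x∈ y≼x Ny≼Nx))

-- The hypotheses on y say that its codeword is supported inside that of the run
-- x; the scalar is the value of y at the first element of the run.
run-multiple : ∀ {n} {x y : 𝔽₂^ n} → x ∈ runs n →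
  y ≼ x → neighbourSums 0ℙ y ≼ neighbourSums 0ℙ x → ∃ λ b → y ≡ b *ᵥ x
run-multiple {suc n} x∈ y≼x Ny≼Nx with ∈-++⁻ (List.map (0ℙ ∷_) (runs n)) x∈
... | inj₁ x∈₀ with ∈-map⁻ _ x∈₀
run-multiple {suc n} {y = 0ℙ ∷ y} _ (_ ∷ y≼x) (_ ∷ Ny≼Nx) | inj₁ _ | x , x∈ , refl
  with b , refl ← run-multiple x∈ y≼x Ny≼Nx = b , cong (_∷ (b *ᵥ x)) (sym (ℙ.*-zeroʳ b))
run-multiple {suc n} _ y≼x Ny≼Nx | inj₂ x∈₁ with ∈-map⁻ _ x∈₁
run-multiple {suc n} {y = b ∷ y} _ (_ ∷ y≼x) (_ ∷ Ny≼Nx) | inj₂ _ | x , x∈ , refl =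
  b , cong₂ _∷_ (sym (ℙ.*-identityʳ b)) (tail-multiple x∈ y≼x Ny≼Nx)

first-tail : ∀ {n} {x : 𝔽₂^ n} → x ∈ tails n → first x ≡ 0ℙ
first-tail {zero}        (here refl) = refl
first-tail {suc zero}    (here refl) = refl
first-tail {suc (suc n)} (here refl) = refl
first-tail {suc (suc n)} (there x∈) with _ , _ , refl ← ∈-map⁻ _ x∈ = refl

-- After a 1, follow the alternating pattern 0101… for as long as x has a 1 at
-- the required places.  The pattern may stop as soon as a 1 is missing, because
-- x then has an odd neighbour sum at the place where the tail does.
tail-below : ∀ {n} (x : 𝔽₂^ n) → ∃ λ y → y ∈ tails n ×
  y ≼ x × neighbourSums 1ℙ y ≼ neighbourSums 1ℙ x
tail-below []       = [] , here refl , [] , []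
tail-below (a ∷ []) = 0ℙ ∷ [] , here refl , (0≤ a) ∷ [] , 1≤1 ∷ []
tail-below {suc (suc n)} (a ∷ 0ℙ ∷ x) =
  0ᵥ , here refl , 0≼ _ ,
  1≤1 ∷ subst (_≼ neighbourSums a (0ℙ ∷ x)) (sym (neighbourSums-0 (suc n))) (0≼ _)
tail-below (a ∷ 1ℙ ∷ x) with y , y∈ , y≼x , Ny≼Nx ← tail-below x =
  0ℙ ∷ 1ℙ ∷ y , there (∈-map⁺ _ y∈) , (0≤ a) ∷ 1≤1 ∷ y≼x ,
  (0≤ _) ∷ subst (_≤₂ (a ℙ.+ first x)) (sym (first-tail y∈)) (0≤ _) ∷ Ny≼Nx

-- Every nonzero word dominates a run: the component of its first 1.
run-below : ∀ {n} (x : 𝔽₂^ n) → x ≢ 0ᵥ → ∃ λ y → y ∈ runs n ×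
  y ≼ x × neighbourSums 0ℙ y ≼ neighbourSums 0ℙ x
run-below []       x≢0 = ⊥-elim (x≢0 refl)
run-below (0ℙ ∷ x) x≢0 with y , y∈ , y≼x , Ny≼Nx ← run-below x (x≢0 ∘ cong (0ℙ ∷_)) =
  0ℙ ∷ y , ∈-++⁺ˡ (∈-map⁺ _ y∈) , (0≤ _) ∷ y≼x , first-mono y≼x ∷ Ny≼Nx
run-below (1ℙ ∷ x) x≢0 with y , y∈ , y≼x , Ny≼Nx ← tail-below x =
  1ℙ ∷ y , ∈-++⁺ʳ _ (∈-map⁺ _ y∈) , 1≤1 ∷ y≼x ,
  subst (_≤₂ first x) (sym (first-tail y∈)) (0≤ _) ∷ Ny≼Nx

run≢0 : ∀ {n} {x : 𝔽₂^ n} → x ∈ runs n → x ≢ 0ᵥ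
run≢0 {suc n} x∈ x≡0 with ∈-++⁻ (List.map (0ℙ ∷_) (runs n)) x∈
... | inj₁ x∈₀ with _ , x∈′ , refl ← ∈-map⁻ _ x∈₀ = run≢0 x∈′ (Vec.∷-injectiveʳ x≡0)
... | inj₂ x∈₁ with _ , _ , refl ← ∈-map⁻ _ x∈₁ with () ← x≡0

-- Minimal codewords are the codewords of runs

run⇒minimal : ∀ {n} {x : 𝔽₂^ n} → x ∈ runs n →
  IsMinimal (code (path n)) (codeword x)
run⇒minimal {n} {x} x∈ =
  (x , linearCombination-code x) , codeword≢0 (run≢0 x∈) , no-smaller
  where
  no-smaller : ¬ (∃ λ c → code (path n) c × c ≢ 0ᵥ × supp c ⊂ supp (codeword x))
  no-smaller (_ , (y , refl) , c≢0 , c⊂x)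
    rewrite linearCombination-code y
    with c⊆x , i , i∈x , i∉c ← c⊂x
    with le ← ⊆⇒≼ (codeword y) (codeword x) c⊆x
    with run-multiple x∈ (Pointwise.++ˡ⁻ y x le) (Pointwise.++ʳ⁻ y x le)
  ... | 0ℙ , refl = c≢0 (trans (cong codeword (*ᵥ-zeroˡ x)) (codeword-0 n))
  ... | 1ℙ , refl = i∉c (subst (λ z → i Subset.∈ supp (codeword z)) (sym (*ᵥ-identityˡ x)) i∈x)

minimal⇒run : ∀ {n} {c : 𝔽₂^ (n + n)} → IsMinimal (code (path n)) c →
  ∃ λ x → x ∈ runs n × c ≡ codeword x
minimal⇒run {n} ((x , refl) , c≢0 , no-smaller)
  rewrite linearCombination-code x
  with y , y∈ , y≼x , Ny≼Nx ← run-below x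
         (λ x≡0 → c≢0 (trans (cong codeword x≡0) (codeword-0 n)))
  = y , y∈ , supp-injective (⊆-antisym x⊆y y⊆x)
  where
  y⊆x : supp (codeword y) ⊆ supp (codeword x)
  y⊆x = ≼⇒⊆ (Pointwise.++⁺ y≼x Ny≼Nx)

  -- By minimality of the codeword of x: a position in its support but not in that
  -- of the codeword of y would make the latter strictly smaller.
  x⊆y : supp (codeword x) ⊆ supp (codeword y)
  x⊆y {i} i∈x with i ∈? supp (codeword y)
  ... | yes i∈y = i∈y
  ... | no  i∉y = ⊥-elim (no-smaller
    (codeword y , (y , linearCombination-code y) , codeword≢0 (run≢0 y∈) ,
     y⊆x , i , i∈x , i∉y))

-- Counting

tails-unique : ∀ n → Unique (tails n)
tails-unique zero          = [] ∷ []
tails-unique (suc zero)    = [] ∷ []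
tails-unique (suc (suc n)) =
  All.tabulate 0∉ ∷
  Unique.map⁺ (λ eq → Vec.∷-injectiveʳ (Vec.∷-injectiveʳ eq)) (tails-unique n)
  where
  0∉ : ∀ {x} → x ∈ List.map (λ x → 0ℙ ∷ 1ℙ ∷ x) (tails n) → 0ᵥ ≢ x
  0∉ x∈ 0≡x with _ , _ , refl ← ∈-map⁻ _ x∈ with () ← 0≡x

runs-unique : ∀ n → Unique (runs n)
runs-unique zero    = []
runs-unique (suc n) =
  Unique.++⁺ (Unique.map⁺ Vec.∷-injectiveʳ (runs-unique n))
             (Unique.map⁺ Vec.∷-injectiveʳ (tails-unique n))
             disjoint
  where
  disjoint : ∀ {x} → ¬ (x ∈ List.map (0ℙ ∷_) (runs n) × x ∈ List.map (1ℙ ∷_) (tails n))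
  disjoint (x∈₀ , x∈₁) with _ , _ , refl ← ∈-map⁻ _ x∈₀ with _ , _ , () ← ∈-map⁻ _ x∈₁

length-tails : ∀ n → length (tails n) ≡ suc ⌊ n /2⌋
length-tails zero          = refl
length-tails (suc zero)    = refl
length-tails (suc (suc n)) = cong suc (trans (List.length-map _ (tails n)) (length-tails n))

length-runs : ∀ n → length (runs n) ≡ ⌊ suc n /2⌋ * ⌈ suc n /2⌉
length-runs zero    = refl
length-runs (suc n) = begin
  length (List.map (0ℙ ∷_) (runs n) List.++ List.map (1ℙ ∷_) (tails n))
    ≡⟨ List.length-++ (List.map (0ℙ ∷_) (runs n)) ⟩
  length (List.map (0ℙ ∷_) (runs n)) + length (List.map (1ℙ ∷_) (tails n))
    ≡⟨ cong₂ _+_ (List.length-map _ (runs n)) (List.length-map _ (tails n)) ⟩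
  length (runs n) + length (tails n)
    ≡⟨ cong₂ _+_ (length-runs n) (length-tails n) ⟩
  ⌈ n /2⌉ * suc ⌊ n /2⌋ + suc ⌊ n /2⌋
    ≡⟨ rearrange ⌈ n /2⌉ ⌊ n /2⌋ ⟩
  suc ⌊ n /2⌋ * suc ⌈ n /2⌉ ∎
  where
  open ≡-Reasoning
  rearrange : ∀ c f → c * suc f + suc f ≡ suc f * suc c
  rearrange = solve-∀

M-path : ∀ n → M (path n) ≡ length (runs n)
M-path n = trans (↭-length (∼bag⇒↭ (unique∧set⇒bag
    (Unique.filter⁺ minimal? (allVectors-unique (n + n)))
    (Unique.map⁺ codeword-injective (runs-unique n))
    (mk⇔ to from))))
  (List.length-map codeword (runs n))
  where
  minimal? = isMinimal? (code? (path n))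

  to : ∀ {c} → c ∈ filter minimal? (allVectors (n + n)) → c ∈ List.map codeword (runs n)
  to c∈ with _ , c-min ← ∈-filter⁻ minimal? {xs = allVectors (n + n)} c∈
        with _ , x∈ , refl ← minimal⇒run {n} c-min = ∈-map⁺ codeword x∈

  from : ∀ {c} → c ∈ List.map codeword (runs n) → c ∈ filter minimal? (allVectors (n + n))
  from c∈ with _ , x∈ , refl ← ∈-map⁻ codeword c∈ =
    ∈-filter⁺ minimal? (allVectors-complete _) (run⇒minimal x∈)

n²/4 : ∀ n → (n ^ 2) / 4 ≡ ⌊ n /2⌋ * ⌈ n /2⌉
n²/4 zero          = refl
n²/4 (suc zero)    = refl
n²/4 (suc (suc n)) = begin
  (suc (suc n) ^ 2) / 4
    ≡⟨ cong (_/ 4) (square n) ⟩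
  (suc n * 4 + n ^ 2) / 4
    ≡⟨ +-distrib-/-∣ˡ (n ^ 2) (n∣m*n (suc n)) ⟩
  (suc n * 4) / 4 + (n ^ 2) / 4
    ≡⟨ cong₂ _+_ (m*n/n≡m (suc n) 4) (n²/4 n) ⟩
  suc n + ⌊ n /2⌋ * ⌈ n /2⌉
    ≡⟨ cong (λ k → suc k + ⌊ n /2⌋ * ⌈ n /2⌉) (sym (ℕ.⌊n/2⌋+⌈n/2⌉≡n n)) ⟩
  suc (⌊ n /2⌋ + ⌈ n /2⌉) + ⌊ n /2⌋ * ⌈ n /2⌉
    ≡⟨ factor ⌊ n /2⌋ ⌈ n /2⌉ ⟩
  suc ⌊ n /2⌋ * suc ⌈ n /2⌉ ∎
  where
  open ≡-Reasoning
  square : ∀ n → suc (suc n) * (suc (suc n) * 1) ≡ suc n * 4 + n * (n * 1)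
  square = solve-∀
  factor : ∀ f c → suc (f + c) + f * c ≡ suc f * suc c
  factor = solve-∀

proposition3p6 : (n : ℕ) → 1 ≤ n →
    (M (path n) ≡ ((n + 1) ^ 2) / 4) ×
    (((n + 1) ^ 2) / 4 ≡ ⌊ n + 1 /2⌋ * ⌈ n + 1 /2⌉)
proposition3p6 n _ = trans count (sym (n²/4 (n + 1))) , n²/4 (n + 1)
  where
  count : M (path n) ≡ ⌊ n + 1 /2⌋ * ⌈ n + 1 /2⌉
  count = trans (M-path n)
    (subst (λ k → length (runs n) ≡ ⌊ k /2⌋ * ⌈ k /2⌉) (ℕ.+-comm 1 n) (length-runs n))
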